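{- For integers $k$ and $h\ge1$, let $U(p;k,h)$ be the number of $u\in\{0,\ldots,p-1\}$ for which $q_p(u)\equiv z\pmod p$ for some integer $z\in[k+1,k+h]$. Then for any integers $k$ and $h\ge 1$, $$U(p;k,h)\le h^{1/2}p^{1/2+o(1)}$$ as $p\to\infty$ over primes.
   Context: For a prime $p$ and an integer $u$ with $\gcd(u,p)=1$, the Fermat quotient $q_p(u)$ is the unique integer with $q_p(u)\equiv (u^{p-1}-1)/p \pmod p$ and $0\le q_p(u)\le p-1$; also $q_p(kp)=0$ for all $k\in\mathbb Z$. -}

module Defs where

open import Data.Nat using (ℕ; zero; suc; _∸_; _^_; _/_; _%_; _≡ᵇ_)
open import Data.Integer using (ℤ; +_; _-_; _%ℕ_)
open import Data.Bool using (Bool; true; false; if_then_else_)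
open import Data.List using (List; upTo; filter; length)
open import Data.Bool.ListAction using (any)
open import Relation.Nullary.Decidable using (does)
open import Relation.Binary.PropositionalEquality using (_≡_)
open import Data.Bool using (T)
open import Relation.Unary using (Decidable)
open import Data.Bool.Properties using (T?)

-- Fermat quotient q_p(u) ∈ {0,…,p-1}, for a modulus written as suc m (= p).
-- If p ∣ u then q_p(u) = 0; otherwise q_p(u) = ((u^(p-1) - 1)/p) mod p
-- (for p prime and p ∤ u the division is exact by Fermat's little theorem).
fermatQuotient : ℕ → ℕ → ℕ
fermatQuotient zero    u = 0
fermatQuotient (suc m) u =
  if (u % suc m) ≡ᵇ 0 then 0 else (((u ^ m) ∸ 1) / suc m) % suc m

hits : ℕ → ℤ → ℕ → ℕ → Bool
hits zero    k h u = false
hits (suc m) k h u =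
  any (λ j → ((+ fermatQuotient (suc m) u - k - + suc j) %ℕ suc m) ≡ᵇ 0) (upTo h)

U : ℕ → ℤ → ℕ → ℕ
U p k h = length (filter (λ u → T? (hits p k h u)) (upTo p))

{-# OPTIONS --safe #-}

-- Write u ^ (p-1) = 1 + p Q(u), so that q_p(u) is Q(u) modulo p and Q is additive modulo p.
-- Since x ≡ y (mod p) implies x ^ p ≡ y ^ p (mod p²), an integer coprime to p is determined
-- modulo p² by its residue modulo p and its Fermat quotient.  If u and v are counted by
-- U(p;k,h), then q_p(uv) takes at most 2h values modulo p, so the product uv < p² takes at
-- most 2hp values; each value w arises from at most τ(w) = p^o(1) pairs (u, v).
-- The divisor bound comes from τ(mn) ≤ τ(m) τ(n): a prime power q ^ a with q < 2 ^ k costs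
-- (a+1) ^ k ≤ k ^ k 2 ^ a in τ ^ k, and a prime q ≥ 2 ^ k costs 2 ^ k ≤ q.
module Submission where

open import Defs
open import Data.Bool.Base using (true; false; T; if_then_else_)
open import Data.Bool.Properties using (T?)
open import Data.Integer.Base as ℤ using (ℤ; +_; _%ℕ_; _/ℕ_; 0ℤ; 1ℤ) renaming (_+_ to _+ℤ_; _*_ to _*ℤ_; _-_ to _-ℤ_; _^_ to _^ℤ_)
open import Data.Integer.DivMod using (a≡a%ℕn+[a/ℕn]*n; n%ℕd<d)
open import Data.Integer.Divisibility.Signed as ℤ using (∣m∣n⇒∣m+n; ∣m∣n⇒∣m-n; ∣n⇒∣m*n; ∣m⇒∣m*n; *-monoʳ-∣; ∣⇒∣ᵤ) renaming (_∣_ to _∣ℤ_)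
import Data.Integer.Properties as ℤ
open import Data.Integer.Tactic.RingSolver using (solve-∀)
open import Data.List.Base using (List; []; _∷_; _++_; length; map; filter; upTo; applyUpTo; cartesianProduct; cartesianProductWith)
open import Data.List.Membership.Propositional using (_∈_; find)
open import Data.List.Membership.Propositional.Properties
open import Data.List.Properties using (length-++; length-++-≤ˡ; length-map; length-upTo; length-applyUpTo; ++-identityʳ)
open import Data.List.Relation.Binary.Permutation.Propositional using (_↭_; prep; ↭-refl; ↭-trans; ↭-reflexive)
open import Data.List.Relation.Binary.Permutation.Propositional.Properties using (shift; ↭-length; ∈-resp-↭)
open import Data.List.Relation.Binary.Subset.Propositional using (_⊆_)
open import Data.List.Relation.Unary.All as All using (All; []; _∷_)
open import Data.List.Relation.Unary.All.Properties using (applyUpTo⁺₁)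
open import Data.List.Relation.Unary.AllPairs using (_∷_)
open import Data.List.Relation.Unary.Any using (here; there)
open import Data.List.Relation.Unary.Any.Properties using (any⁻)
open import Data.List.Relation.Unary.Unique.Propositional using (Unique)
import Data.List.Relation.Unary.Unique.Propositional.Properties as Unique
open import Data.Nat.Base
open import Data.Nat.Coprimality using (coprime-divisor; Bézout-coprime)
open import Data.Nat.Divisibility using (_∣_; divides; 0∣⇒≡0; >⇒∤; ∣1⇒≡1; m%n≡0⇒n∣m)
open import Data.Nat.DivMod using (m≡m%n+[m/n]*n; m%n<n; m%n≤m; m/n*n≤m; m/n*n≡m; %-distribˡ-*; m%n%n≡m%n; m<n⇒m%n≡m)
open import Data.Nat.GCD using (module GCD; module Bézout)
open import Data.Nat.ListAction using (product)
open import Data.Nat.ListAction.Properties using (product-↭)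
open import Data.Nat.Primality using (Prime; prime?; euclidsLemma; prime⇒nonZero; prime⇒nonTrivial; productOfPrimes≥1; ¬prime[0]; ¬prime[1])
open import Data.Nat.Primality.Factorisation using (PrimeFactorisation; factorise)
open import Data.Nat.Properties
open import Data.Nat.Tactic.RingSolver using () renaming (solve-∀ to ℕ-solve-∀)
open import Algebra.Properties.CommutativeSemigroup *-commutativeSemigroup using (interchange; xy∙z≈xz∙y; x∙yz≈z∙xy; x∙yz≈yx∙z; x∙yz≈y∙zx; x∙yz≈y∙xz)
open import Data.Product.Base using (∃; ∃₂; _×_; _,_; proj₁; proj₂)
open import Data.Product.Properties using (≡-dec)
open import Data.Sum.Base using (inj₁; inj₂; [_,_]′)
open import Function.Base using (_∘_; _$_)
open import Relation.Binary.Definitions using (DecidableEquality)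
open import Relation.Binary.PropositionalEquality
open import Relation.Nullary using (Dec; yes; no; ¬_; ¬?; contradiction)

-- Counting with duplicate-free lists

private variable
  A B C : Set

-- Each entry of `xs` is removed from `ys` at one occurrence; uniqueness ensures that later entries
-- do not rely on that occurrence. The leftover `zs` yields the length bound and, when empty, the
-- permutation behind Fermat's little theorem.
unique-⊆⇒↭-++ : {xs ys : List A} → Unique xs → xs ⊆ ys → ∃ λ zs → ys ↭ xs ++ zs
unique-⊆⇒↭-++ {xs = []} {ys} _ _ = ys , ↭-refl
unique-⊆⇒↭-++ {xs = x ∷ xs} (x∉xs ∷ xs!) xs⊆ys
  with as , bs , refl ← ∈-∃++ (xs⊆ys (here refl)) =
  let zs , r = unique-⊆⇒↭-++ xs! xs⊆as++bs
  in zs , ↭-trans (shift x as bs) (prep x r)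
  where
  xs⊆as++bs : xs ⊆ as ++ bs
  xs⊆as++bs z∈xs with ∈-resp-↭ (shift x as bs) (xs⊆ys (there z∈xs))
  ... | here z≡x = contradiction (sym z≡x) (All.lookup x∉xs z∈xs)
  ... | there z∈ = z∈

unique-⊆⇒length-≤ : {xs ys : List A} → Unique xs → xs ⊆ ys → length xs ≤ length ys
unique-⊆⇒length-≤ {xs = xs} xs! xs⊆ys with zs , r ← unique-⊆⇒↭-++ xs! xs⊆ys =
  subst (length xs ≤_) (sym (↭-length r)) (length-++-≤ˡ xs)

unique-⊆⇒↭ : {xs ys : List A} → Unique xs → xs ⊆ ys → length xs ≡ length ys → ys ↭ xs
unique-⊆⇒↭ {xs = xs} xs! xs⊆ys eq with unique-⊆⇒↭-++ xs! xs⊆ys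
... | []     , r = ↭-trans r (↭-reflexive (++-identityʳ xs))
... | z ∷ zs , r = contradiction
  (trans eq (trans (↭-length r) (length-++ xs))) (<⇒≢ (m<m+n (length xs) z<s))

length-filter-¬ : {P : A → Set} (P? : ∀ x → Dec (P x)) (xs : List A) →
  length xs ≡ length (filter P? xs) + length (filter (¬? ∘ P?) xs)
length-filter-¬ P? [] = refl
length-filter-¬ P? (x ∷ xs) with P? x
... | yes _ = cong suc (length-filter-¬ P? xs)
... | no  _ = trans (cong suc (length-filter-¬ P? xs)) (sym (+-suc _ _))

-- Pigeonhole, peeling off one fibre per entry of `ys`. The bound is assumed for every
-- duplicate-free list inside a fibre, so it passes to the sublist that remains.
length-fibres : DecidableEquality B → (f : A → B) (T : ℕ) (ys : List B) {xs : List A} →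
  Unique xs → (∀ {x} → x ∈ xs → f x ∈ ys) →
  (∀ y {zs} → Unique zs → zs ⊆ xs → (∀ {z} → z ∈ zs → f z ≡ y) → length zs ≤ T) →
  length xs ≤ length ys * T
length-fibres _≟B_ f T [] {[]} _ _ _ = z≤n
length-fibres _≟B_ f T [] {x ∷ xs} _ f∈ _ = contradiction (f∈ (here refl)) λ ()
length-fibres {B} {A} _≟B_ f T (y ∷ ys) {xs} xs! f∈ fibre = begin
  length xs                                        ≡⟨ length-filter-¬ f≟y xs ⟩
  length (filter f≟y xs) + length (filter f≢y xs)  ≤⟨ +-mono-≤ onFibre offFibre ⟩
  T + length ys * T                                ∎
  where
  open ≤-Reasoning
  f≟y = λ x → f x ≟B y
  f≢y = ¬? ∘ f≟y
  onFibre : length (filter f≟y xs) ≤ T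
  onFibre = fibre y (Unique.filter⁺ f≟y xs!) (proj₁ ∘ ∈-filter⁻ f≟y) (proj₂ ∘ ∈-filter⁻ f≟y {xs = xs})
  f∈ys : ∀ {x} → x ∈ filter f≢y xs → f x ∈ ys
  f∈ys x∈ with ∈-filter⁻ f≢y x∈
  ... | x∈xs , fx≢y with f∈ x∈xs
  ...   | here fx≡y = contradiction fx≡y fx≢y
  ...   | there fx∈ = fx∈
  offFibre : length (filter f≢y xs) ≤ length ys * T
  offFibre = length-fibres _≟B_ f T ys (Unique.filter⁺ f≢y xs!) f∈ys
    λ y′ zs! zs⊆ → fibre y′ zs! (proj₁ ∘ ∈-filter⁻ f≢y ∘ zs⊆)

length-cartesianProductWith : (f : A → B → C) (xs : List A) (ys : List B) →
  length (cartesianProductWith f xs ys) ≡ length xs * length ys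
length-cartesianProductWith f [] ys = refl
length-cartesianProductWith f (x ∷ xs) ys = trans (length-++ (map (f x) ys))
  (cong₂ _+_ (length-map (f x) ys) (length-cartesianProductWith f xs ys))

-- The divisor bound

^-distribʳ-* : ∀ m n k → (m * n) ^ k ≡ m ^ k * n ^ k
^-distribʳ-* m n zero = refl
^-distribʳ-* m n (suc k) = trans (cong (m * n *_) (^-distribʳ-* m n k)) (interchange m n (m ^ k) (n ^ k))

FactorPair : ℕ → ℕ × ℕ → Set
FactorPair n (x , y) = x * y ≡ n

factorPair? : ∀ n r → Dec (FactorPair n r)
factorPair? n (x , y) = x * y ≟ n

factorPairs : ℕ → List (ℕ × ℕ)
factorPairs n =
  filter (factorPair? n) (cartesianProduct (upTo (suc n)) (upTo (suc n)))

-- For nonzero `n` this is the number of divisors. Ordered factorisations are counted because pairs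
-- of hits with a prescribed product are themselves such factorisations.
τ : ℕ → ℕ
τ n = length (factorPairs n)

factorPairs-unique : ∀ n → Unique (factorPairs n)
factorPairs-unique n =
  Unique.filter⁺ (factorPair? n) (Unique.cartesianProduct⁺ (Unique.upTo⁺ (suc n)) (Unique.upTo⁺ (suc n)))

∈-factorPairs⁺ : ∀ {x y n} .{{_ : NonZero n}} → x * y ≡ n → (x , y) ∈ factorPairs n
∈-factorPairs⁺ {x} {y} {n} refl =
  ∈-filter⁺ (factorPair? n) (∈-cartesianProduct⁺ (∈-upTo⁺ (s≤s (m≤m*n x y {{y≢0}}))) (∈-upTo⁺ (s≤s (m≤n*m y x {{x≢0}})))) refl
  where
  x≢0 = m*n≢0⇒m≢0 x
  y≢0 = m*n≢0⇒n≢0 x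

∈-factorPairs⁻ : ∀ n {x y} → (x , y) ∈ factorPairs n → x * y ≡ n
∈-factorPairs⁻ n = proj₂ ∘ ∈-filter⁻ (factorPair? n) {xs = cartesianProduct (upTo (suc n)) (upTo (suc n))}

-- With g = gcd x m the four factors are g, m / g, x / g and y g / m.
factorPair-splits : ∀ m n x y .{{_ : NonZero (m * n)}} → x * y ≡ m * n →
  ∃₂ λ (r s : ℕ × ℕ) → (proj₁ r * proj₂ r ≡ m) × (proj₁ s * proj₂ s ≡ n) ×
    (x , y) ≡ (proj₁ r * proj₁ s , proj₂ r * proj₂ s)
factorPair-splits m n x y xy≡mn with Bézout.lemma x m
... | Bézout.result zero d _ =
  contradiction (0∣⇒≡0 (proj₂ (GCD.commonDivisor d))) (≢-nonZero⁻¹ m {{m*n≢0⇒m≢0 m}})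
... | Bézout.result g@(suc _) d b
  with divides x′ refl , divides m′ refl ← GCD.commonDivisor d
  with eq ← *-cancelʳ-≡ (x′ * y) (m′ * n) g
              (trans (xy∙z≈xz∙y x′ y g) (trans xy≡mn (xy∙z≈xz∙y m′ g n)))
  with divides n′ refl ← coprime-divisor {n = m′} {o = n} (Bézout-coprime b)
                           (divides y (trans (sym eq) (*-comm x′ y))) =
  (g , m′) , (x′ , n′) , *-comm g m′ , *-comm x′ n′ ,
  cong₂ _,_ (*-comm x′ g)
    (*-cancelˡ-≡ y (m′ * n′) x′ {{x′≢0 x′ n′}} (trans eq (x∙yz≈z∙xy m′ n′ x′)))
  where
  x′≢0 : ∀ x′ n′ .{{_ : NonZero (m * (n′ * x′))}} → NonZero x′
  x′≢0 x′ n′ = m*n≢0⇒n≢0 n′ {{m*n≢0⇒n≢0 m}}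

-- By `factorPair-splits`, componentwise multiplication reaches every factor pair of `m * n`.
-- Without coprimality a pair may split in several ways, hence only an inequality.
τ-submultiplicative : ∀ m n .{{_ : NonZero (m * n)}} → τ (m * n) ≤ τ m * τ n
τ-submultiplicative m n = begin
  τ (m * n)                                                       ≤⟨ unique-⊆⇒length-≤ (factorPairs-unique (m * n)) splits ⟩
  length (cartesianProductWith _⊗_ (factorPairs m) (factorPairs n)) ≡⟨ length-cartesianProductWith _⊗_ (factorPairs m) (factorPairs n) ⟩
  τ m * τ n                                                       ∎
  where
  open ≤-Reasoning
  _⊗_ : ℕ × ℕ → ℕ × ℕ → ℕ × ℕ
  (a , b) ⊗ (c , d) = a * c , b * d
  splits : factorPairs (m * n) ⊆ cartesianProductWith _⊗_ (factorPairs m) (factorPairs n)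
  splits {x , y} xy∈ with r , s , r≡ , s≡ , refl ← factorPair-splits m n x y (∈-factorPairs⁻ (m * n) xy∈) =
    ∈-cartesianProductWith⁺ _⊗_
      (∈-factorPairs⁺ {x = proj₁ r} {{m*n≢0⇒m≢0 m}} r≡) (∈-factorPairs⁺ {x = proj₁ s} {{m*n≢0⇒n≢0 m}} s≡)

-- Euclid's lemma finds a factor `q` in `x` or in `y`; cancelling it lowers the exponent by one.
primePower-factorPair : ∀ {q} → Prime q → ∀ a x y → x * y ≡ q ^ a →
  ∃ λ i → i ≤ a × (x , y) ≡ (q ^ i , q ^ (a ∸ i))
primePower-factorPair pr zero x y eq =
  0 , z≤n , cong₂ _,_ (m*n≡1⇒m≡1 x y eq) (m*n≡1⇒n≡1 x y eq)
primePower-factorPair {q} pr (suc a) x y eq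
  with euclidsLemma x y pr (divides (q ^ a) (trans eq (*-comm q (q ^ a))))
... | inj₁ (divides x′ refl)
  with i , i≤a , refl ← primePower-factorPair pr a x′ y
         (*-cancelˡ-≡ _ _ q {{prime⇒nonZero pr}} (trans (x∙yz≈yx∙z q x′ y) eq)) =
  suc i , s≤s i≤a , cong (_, q ^ (a ∸ i)) (*-comm (q ^ i) q)
... | inj₂ (divides y′ refl)
  with i , i≤a , refl ← primePower-factorPair pr a x y′
         (*-cancelˡ-≡ _ _ q {{prime⇒nonZero pr}} (trans (x∙yz≈y∙zx q x y′) eq)) =
  i , m≤n⇒m≤1+n i≤a , cong (q ^ i ,_) (trans (*-comm (q ^ (a ∸ i)) q) (cong (q ^_) (sym (+-∸-assoc 1 i≤a))))

τ-primePower : ∀ {q} → Prime q → ∀ a → τ (q ^ a) ≤ suc a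
τ-primePower {q} pr a = begin
  τ (q ^ a)                        ≤⟨ unique-⊆⇒length-≤ (factorPairs-unique (q ^ a)) ⊆powers ⟩
  length (map powers (upTo (suc a))) ≡⟨ trans (length-map powers (upTo (suc a))) (length-upTo (suc a)) ⟩
  suc a                            ∎
  where
  open ≤-Reasoning
  powers : ℕ → ℕ × ℕ
  powers i = q ^ i , q ^ (a ∸ i)
  ⊆powers : factorPairs (q ^ a) ⊆ map powers (upTo (suc a))
  ⊆powers {x , y} xy∈ with i , i≤a , refl ← primePower-factorPair pr a x y (∈-factorPairs⁻ (q ^ a) xy∈) =
    ∈-map⁺ powers (∈-upTo⁺ (s≤s i≤a))

-- Writing a = r + j k with r < k gives a + 1 ≤ k (j + 1) ≤ k 2 ^ j.
poly≤exp : ∀ k .{{_ : NonZero k}} a → suc a ^ k ≤ k ^ k * 2 ^ a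
poly≤exp k a = begin
  suc a ^ k             ≤⟨ ^-monoˡ-≤ k suc-a≤ ⟩
  (k * 2 ^ j) ^ k       ≡⟨ ^-distribʳ-* k (2 ^ j) k ⟩
  k ^ k * (2 ^ j) ^ k   ≡⟨ cong (k ^ k *_) (^-*-assoc 2 j k) ⟩
  k ^ k * 2 ^ (j * k)   ≤⟨ *-monoʳ-≤ (k ^ k) (^-monoʳ-≤ 2 (m/n*n≤m a k)) ⟩
  k ^ k * 2 ^ a         ∎
  where
  open ≤-Reasoning
  j = a / k
  suc≤2^ : ∀ j → suc j ≤ 2 ^ j
  suc≤2^ zero = ≤-refl
  suc≤2^ (suc j) = +-mono-≤ (m^n>0 2 j) (≤-trans (suc≤2^ j) (m≤m+n _ 0))
  suc-a≤ : suc a ≤ k * 2 ^ j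
  suc-a≤ = begin
    suc a                  ≡⟨ cong suc (m≡m%n+[m/n]*n a k) ⟩
    suc (a % k) + j * k    ≤⟨ +-monoˡ-≤ (j * k) (m%n<n a k) ⟩
    suc j * k              ≡⟨ *-comm (suc j) k ⟩
    k * suc j              ≤⟨ *-monoʳ-≤ k (suc≤2^ j) ⟩
    k * 2 ^ j              ∎

-- Collecting every copy of `q` raises the lower bound on the remaining primes to `suc q`, as the
-- recursion in `τ-roughBound` requires.
product-split : ∀ {q} → ∀ ps → All Prime ps → All (q ≤_) ps →
  ∃₂ λ a ps′ → product ps ≡ q ^ a * product ps′ × All Prime ps′ × All (q <_) ps′
product-split [] [] [] = 0 , [] , refl , [] , []
product-split {q} (p ∷ ps) (p-prime ∷ primes) (q≤p ∷ q≤ps)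
  with a , ps′ , eq , primes′ , q<ps′ ← product-split ps primes q≤ps | q ≟ p
... | yes refl = suc a , ps′ , trans (cong (p *_) eq) (sym (*-assoc p (p ^ a) _)) , primes′ , q<ps′
... | no q≢p = a , p ∷ ps′ , trans (cong (p *_) eq) (x∙yz≈y∙xz p (q ^ a) (product ps′)) ,
               p-prime ∷ primes′ , ≤∧≢⇒< q≤p q≢p ∷ q<ps′

product-nonZero : ∀ {ps} → All Prime ps → NonZero (product ps)
product-nonZero primes = >-nonZero (productOfPrimes≥1 primes)

module _ (k : ℕ) .{{_ : NonZero k}} where

  open ≤-Reasoning

  -- Primes are peeled off one at a time, repetitions included; each at most doubles τ, which costs
  -- `2 ^ k ≤ p` in the power.
  τ-largePrimes : ∀ ps → All Prime ps → All (2 ^ k ≤_) ps → τ (product ps) ^ k ≤ product ps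
  τ-largePrimes [] [] [] = ≤-reflexive (^-zeroˡ k)
  τ-largePrimes (p ∷ ps) primes@(p-prime ∷ primes′) (2^k≤p ∷ large) = begin
    τ (p * product ps) ^ k       ≤⟨ ^-monoˡ-≤ k (τ-submultiplicative p (product ps) {{product-nonZero primes}}) ⟩
    (τ p * τ (product ps)) ^ k   ≤⟨ ^-monoˡ-≤ k (*-monoˡ-≤ (τ (product ps)) τp≤2) ⟩
    (2 * τ (product ps)) ^ k     ≡⟨ ^-distribʳ-* 2 (τ (product ps)) k ⟩
    2 ^ k * τ (product ps) ^ k   ≤⟨ *-mono-≤ 2^k≤p (τ-largePrimes ps primes′ large) ⟩
    p * product ps               ∎
    where
    τp≤2 : τ p ≤ 2
    τp≤2 = subst (λ n → τ n ≤ 2) (*-identityʳ p) (τ-primePower p-prime 1)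

  -- `d` is fuel for raising the lower bound `q` to `2 ^ k`, and each step costs one factor `k ^ k`.
  -- If `q` is prime, its full power is stripped and `poly≤exp` applies with 2 ^ a ≤ q ^ a;
  -- otherwise the factor is given away. At `d` = 0 only large primes remain.
  τ-roughBound : ∀ d q → 2 ≤ q → 2 ^ k ≤ d + q → ∀ ps → All Prime ps → All (q ≤_) ps →
    τ (product ps) ^ k ≤ (k ^ k) ^ d * product ps
  τ-roughBound zero q _ 2^k≤q ps primes q≤ps = begin
    τ (product ps) ^ k    ≤⟨ τ-largePrimes ps primes (All.map (≤-trans 2^k≤q) q≤ps) ⟩
    product ps            ≡⟨ +-identityʳ _ ⟨
    1 * product ps        ∎
  τ-roughBound (suc d) q 2≤q 2^k≤ ps primes q≤ps with prime? q
  ... | no ¬prime = begin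
    τ (product ps) ^ k               ≤⟨ τ-roughBound d (suc q) (m≤n⇒m≤1+n 2≤q) 2^k≤′ ps primes q<ps ⟩
    c ^ d * product ps               ≤⟨ *-monoˡ-≤ (product ps) (m≤n*m (c ^ d) c {{m^n≢0 k k}}) ⟩
    c ^ suc d * product ps           ∎
    where
    c = k ^ k
    2^k≤′ = ≤-trans 2^k≤ (≤-reflexive (sym (+-suc d q)))
    q<ps : All (q <_) ps
    q<ps = All.zipWith (λ (pr , q≤p) → ≤∧≢⇒< q≤p λ { refl → ¬prime pr }) (primes , q≤ps)
  ... | yes q-prime with a , ps′ , eq , primes′ , q<ps′ ← product-split ps primes q≤ps = begin
    τ (product ps) ^ k                   ≡⟨ cong (λ n → τ n ^ k) eq ⟩
    τ (q ^ a * m) ^ k                    ≤⟨ ^-monoˡ-≤ k (τ-submultiplicative (q ^ a) m {{subst NonZero eq (product-nonZero primes)}}) ⟩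
    (τ (q ^ a) * τ m) ^ k                ≤⟨ ^-monoˡ-≤ k (*-monoˡ-≤ (τ m) (τ-primePower q-prime a)) ⟩
    (suc a * τ m) ^ k                    ≡⟨ ^-distribʳ-* (suc a) (τ m) k ⟩
    suc a ^ k * τ m ^ k                  ≤⟨ *-mono-≤ (poly≤exp k a)
                                              (τ-roughBound d (suc q) (m≤n⇒m≤1+n 2≤q) 2^k≤′ ps′ primes′ q<ps′) ⟩
    c * 2 ^ a * (c ^ d * m)              ≤⟨ *-monoˡ-≤ (c ^ d * m) (*-monoʳ-≤ c (^-monoˡ-≤ a 2≤q)) ⟩
    c * q ^ a * (c ^ d * m)              ≡⟨ interchange c (q ^ a) (c ^ d) m ⟩
    c ^ suc d * (q ^ a * m)              ≡⟨ cong (c ^ suc d *_) eq ⟨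
    c ^ suc d * product ps               ∎
    where
    c = k ^ k
    2^k≤′ = ≤-trans 2^k≤ (≤-reflexive (sym (+-suc d q)))
    m = product ps′

  -- This is τ(n) = O(n^(1/k)) with the root cleared. The climb starts at the least prime 2, and
  -- fuel `2 ^ k` is generous; it matters only that the constant depends on `k` alone.
  divisorBound : ∃ λ D → ∀ n .{{_ : NonZero n}} → τ n ^ k ≤ D * n
  divisorBound = (k ^ k) ^ (2 ^ k) , λ n →
    let open PrimeFactorisation (factorise n) in
    subst (λ m → τ m ^ k ≤ (k ^ k) ^ (2 ^ k) * m) (sym isFactorisation)
      (τ-roughBound (2 ^ k) 2 ≤-refl (m≤m+n (2 ^ k) 2) factors factorsPrime
        (All.map (λ pr → nonTrivial⇒n>1 _ {{prime⇒nonTrivial pr}}) factorsPrime))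

-- Fermat's little theorem

%≡%⇒∣∸ : ∀ a b n .{{_ : NonZero n}} → a % n ≡ b % n → n ∣ a ∸ b
%≡%⇒∣∸ a b n eq = divides (a / n ∸ b / n) $ begin
  a ∸ b                                       ≡⟨ cong₂ _∸_ (m≡m%n+[m/n]*n a n) (m≡m%n+[m/n]*n b n) ⟩
  (a % n + a / n * n) ∸ (b % n + b / n * n)   ≡⟨ cong (λ r → (r + a / n * n) ∸ (b % n + b / n * n)) eq ⟩
  (b % n + a / n * n) ∸ (b % n + b / n * n)   ≡⟨ [m+n]∸[m+o]≡n∸o (b % n) _ _ ⟩
  a / n * n ∸ b / n * n                       ≡⟨ *-distribʳ-∸ n (a / n) (b / n) ⟨
  (a / n ∸ b / n) * n                         ∎
  where open ≡-Reasoning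

-- For `f` = `suc` this compares the product of the multiples of `u` with a power of `u` times a
-- factorial. A general `f` lets the induction pass to `f ∘ suc`.
product-%-scale : ∀ n .{{_ : NonZero n}} u (f : ℕ → ℕ) l →
  product (applyUpTo (λ i → u * f i % n) l) % n ≡ u ^ l * product (applyUpTo f l) % n
product-%-scale n u f zero = refl
product-%-scale n u f (suc l) = begin
  (x % n * P′) % n               ≡⟨ %-distribˡ-* (x % n) P′ n ⟩
  (x % n % n * (P′ % n)) % n     ≡⟨ cong₂ (λ a b → (a * b) % n) (m%n%n≡m%n x n) (product-%-scale n u (f ∘ suc) l) ⟩
  (x % n * (u ^ l * P % n)) % n  ≡⟨ %-distribˡ-* x (u ^ l * P) n ⟨
  (x * (u ^ l * P)) % n          ≡⟨ cong (_% n) (interchange u (f 0) (u ^ l) P) ⟩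
  (u ^ suc l * (f 0 * P)) % n    ∎
  where
  open ≡-Reasoning
  x = u * f 0
  P = product (applyUpTo (f ∘ suc) l)
  P′ = product (applyUpTo (λ i → u * f (suc i) % n) l)

prime∤product : ∀ {p} → Prime p → ∀ {xs} → All (λ x → ¬ p ∣ x) xs → ¬ p ∣ product xs
prime∤product p-prime [] p∣1 = ¬prime[1] (subst Prime (∣1⇒≡1 p∣1) p-prime)
prime∤product p-prime {x ∷ xs} (p∤x ∷ p∤xs) p∣ with euclidsLemma x (product xs) p-prime p∣
... | inj₁ p∣x  = p∤x p∣x
... | inj₂ p∣xs = prime∤product p-prime p∤xs p∣xs

-- Multiplication by u permutes the nonzero residues modulo p = m + 1.
fermat : ∀ m → Prime (suc m) → ∀ u .{{_ : NonZero u}} → u < suc m → suc m ∣ u ^ m ∸ 1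
fermat m p-prime u u<p with euclidsLemma (u ^ m ∸ 1) F p-prime p∣[u^m∸1]F
  where
  p = suc m
  residues = applyUpTo suc m
  multiples = applyUpTo (λ i → u * suc i % p) m
  F = product residues

  p∤u*i : ∀ i .{{_ : NonZero i}} → i < p → ¬ p ∣ u * i
  p∤u*i i i<p p∣ui with euclidsLemma u i p-prime p∣ui
  ... | inj₁ p∣u = >⇒∤ u<p p∣u
  ... | inj₂ p∣i = >⇒∤ i<p p∣i

  multiples-unique : Unique multiples
  -- Only i < j has to be considered, so a coincidence would give p ∣ u (j - i) with 0 < j - i < p.
  multiples-unique = Unique.applyUpTo⁺₁ _ m λ {i} {j} i<j j<m eq →
    p∤u*i (suc j ∸ suc i) {{>-nonZero (m<n⇒0<n∸m i<j)}} (≤-<-trans (m∸n≤m j i) (m<n⇒m<1+n j<m))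
      (subst (p ∣_) (sym (*-distribˡ-∸ u (suc j) (suc i))) (%≡%⇒∣∸ (u * suc j) (u * suc i) p (sym eq)))

  multiples⊆residues : multiples ⊆ residues
  multiples⊆residues x∈ with i , i<m , refl ← ∈-applyUpTo⁻ _ x∈
    with u * suc i % p in eq | m%n<n (u * suc i) p
  ... | zero  | _         = contradiction (m%n≡0⇒n∣m _ p eq) (p∤u*i (suc i) (s<s i<m))
  ... | suc r | s≤s 1+r≤m = ∈-applyUpTo⁺ suc 1+r≤m

  F%p : u ^ m * F % p ≡ F % p
  F%p = trans (sym (product-%-scale p u suc m)) (cong (_% p) (sym (product-↭
    (unique-⊆⇒↭ multiples-unique multiples⊆residues
      (trans (length-applyUpTo _ m) (sym (length-applyUpTo suc m)))))))

  -- Here `F` is (p-1)!. The congruence u^m F ≡ F is factored, and Euclid's lemma then discards `F`,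
  -- which is prime to p.
  p∣[u^m∸1]F : p ∣ (u ^ m ∸ 1) * F
  p∣[u^m∸1]F = subst (p ∣_)
    (trans (cong (u ^ m * F ∸_) (sym (*-identityˡ F))) (sym (*-distribʳ-∸ F (u ^ m) 1)))
    (%≡%⇒∣∸ (u ^ m * F) F p F%p)
... | inj₁ p∣ = p∣
... | inj₂ p∣F = contradiction p∣F
  (prime∤product p-prime (applyUpTo⁺₁ suc m λ i<m → >⇒∤ (s<s i<m)))

-- Congruences modulo p and p²

-- The bound |a - b| ≤ max(a, b) < n leaves 0 as the only possible multiple of n. With n = p this
-- identifies residues, with n = p² products.
∣-<⇒≡ : ∀ {n a b} → a < n → b < n → + n ∣ℤ + a -ℤ + b → a ≡ b
∣-<⇒≡ {n} {a} {b} a<n b<n n∣a-b =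
  ℤ.+-injective (ℤ.i-j≡0⇒i≡j (+ a) (+ b) (ℤ.∣i∣≡0⇒i≡0 (small (∣⇒∣ᵤ n∣a-b) bound)))
  where
  bound : ℤ.∣ + a -ℤ + b ∣ < n
  bound = ≤-<-trans (subst (λ z → ℤ.∣ z ∣ ≤ a ⊔ b) (sym (ℤ.m-n≡m⊖n a b)) (ℤ.∣m⊝n∣≤m⊔n a b)) (⊔-lub a<n b<n)
  small : ∀ {d} → n ∣ d → d < n → d ≡ 0
  small {zero} _ _ = refl
  small {suc d} n∣d d<n = contradiction n∣d (>⇒∤ d<n)

pos-^ : ∀ u k → + (u ^ k) ≡ (+ u) ^ℤ k
pos-^ u zero = refl
pos-^ u (suc k) = trans (ℤ.pos-* u (u ^ k)) (cong (+ u *ℤ_) (pos-^ u k))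

^ℤ-distribʳ-* : ∀ x y k → (x *ℤ y) ^ℤ k ≡ x ^ℤ k *ℤ y ^ℤ k
^ℤ-distribʳ-* x y zero = refl
^ℤ-distribʳ-* x y (suc k) =
  trans (cong (x *ℤ y *ℤ_) (^ℤ-distribʳ-* x y k)) (lemma x y (x ^ℤ k) (y ^ℤ k))
  where
  lemma : ∀ a b c d → a *ℤ b *ℤ (c *ℤ d) ≡ a *ℤ c *ℤ (b *ℤ d)
  lemma = solve-∀

-- First-order Taylor expansion by induction: multiplying by `y +ℤ s` adds just one new error term,
-- (n+1) y^n s².
binomial-mod-square : ∀ y s n →
  s *ℤ s ∣ℤ (y +ℤ s) ^ℤ suc n -ℤ (y ^ℤ suc n +ℤ + suc n *ℤ y ^ℤ n *ℤ s)
binomial-mod-square y s zero = ℤ.divides 0ℤ (lemma y s)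
  where
  lemma : ∀ y s → (y +ℤ s) *ℤ 1ℤ -ℤ (y *ℤ 1ℤ +ℤ 1ℤ *ℤ 1ℤ *ℤ s) ≡ 0ℤ
  lemma = solve-∀
binomial-mod-square y s (suc n) = subst (s *ℤ s ∣ℤ_)
  (lemma y s ((y +ℤ s) ^ℤ suc n) (y ^ℤ n) (+ suc n))
  (∣m∣n⇒∣m+n (∣n⇒∣m*n (y +ℤ s) (binomial-mod-square y s n)) (ℤ.divides (+ suc n *ℤ y ^ℤ n) refl))
  where
  lemma : ∀ y s X Y N →
    (y +ℤ s) *ℤ (X -ℤ (y *ℤ Y +ℤ N *ℤ Y *ℤ s)) +ℤ N *ℤ Y *ℤ (s *ℤ s) ≡
    (y +ℤ s) *ℤ X -ℤ (y *ℤ (y *ℤ Y) +ℤ (1ℤ +ℤ N) *ℤ (y *ℤ Y) *ℤ s)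
  lemma = solve-∀

module _ (m : ℕ) where

  private
    p = + suc m

  -- With x = y + t p, the linear term of the expansion has one factor p from the exponent and one
  -- from x - y; the remainder is a multiple of (t p)².
  ^p-lifts : ∀ x y → p ∣ℤ x -ℤ y → p *ℤ p ∣ℤ x ^ℤ suc m -ℤ y ^ℤ suc m
  ^p-lifts x y (ℤ.divides t x-y≡tp) = subst (λ z → p *ℤ p ∣ℤ z ^ℤ suc m -ℤ y ^ℤ suc m) y+s≡x
    (subst (p *ℤ p ∣ℤ_) (split ((y +ℤ s) ^ℤ suc m) (y ^ℤ suc m) _)
      (∣m∣n⇒∣m+n (ℤ.∣-trans (ℤ.divides (t *ℤ t) (square t p)) (binomial-mod-square y s m))
                 (ℤ.divides (y ^ℤ m *ℤ t) (linear p (y ^ℤ m) t))))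
    where
    s = t *ℤ p
    y+s≡x : y +ℤ s ≡ x
    y+s≡x = trans (cong (y +ℤ_) (sym x-y≡tp)) (lemma y x)
      where
      lemma : ∀ y x → y +ℤ (x -ℤ y) ≡ x
      lemma = solve-∀
    split : ∀ X Y Z → X -ℤ (Y +ℤ Z) +ℤ Z ≡ X -ℤ Y
    split = solve-∀
    square : ∀ t p → t *ℤ p *ℤ (t *ℤ p) ≡ t *ℤ t *ℤ (p *ℤ p)
    square = solve-∀
    linear : ∀ p Y t → p *ℤ Y *ℤ (t *ℤ p) ≡ Y *ℤ t *ℤ (p *ℤ p)
    linear = solve-∀

  -- x ^ p - y ^ p = (x - y) + p (x A - y B), where the left side and the last term vanish modulo p².
  residue-and-quotient-determine : ∀ x y A B →
    x ^ℤ m ≡ 1ℤ +ℤ p *ℤ A → y ^ℤ m ≡ 1ℤ +ℤ p *ℤ B →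
    p ∣ℤ x -ℤ y → p ∣ℤ A -ℤ B → p *ℤ p ∣ℤ x -ℤ y
  residue-and-quotient-determine x y A B x^m y^m p∣x-y p∣A-B =
    subst (p *ℤ p ∣ℤ_)
      (trans (cong₂ (λ X Y → x *ℤ X -ℤ y *ℤ Y -ℤ p *ℤ ((x -ℤ y) *ℤ A +ℤ y *ℤ (A -ℤ B))) x^m y^m)
             (lemma x y A B p))
      (∣m∣n⇒∣m-n (^p-lifts x y p∣x-y)
        (*-monoʳ-∣ p (∣m∣n⇒∣m+n (∣m⇒∣m*n A p∣x-y) (∣n⇒∣m*n y p∣A-B))))
    where
    lemma : ∀ x y A B p →
      x *ℤ (1ℤ +ℤ p *ℤ A) -ℤ y *ℤ (1ℤ +ℤ p *ℤ B) -ℤ p *ℤ ((x -ℤ y) *ℤ A +ℤ y *ℤ (A -ℤ B)) ≡ x -ℤ y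
    lemma = solve-∀

∣-%ℕ : ∀ n .{{_ : NonZero n}} z → + n ∣ℤ z -ℤ + (z %ℕ n)
∣-%ℕ n z = ℤ.divides (z /ℕ n)
  (trans (cong (_-ℤ + (z %ℕ n)) (a≡a%ℕn+[a/ℕn]*n z n)) (lemma (+ (z %ℕ n)) (z /ℕ n *ℤ + n)))
  where
  lemma : ∀ a b → a +ℤ b -ℤ a ≡ b
  lemma = solve-∀

%ℕ≡⇒∣- : ∀ n .{{_ : NonZero n}} x y → x %ℕ n ≡ y %ℕ n → + n ∣ℤ x -ℤ y
%ℕ≡⇒∣- n x y eq = subst (+ n ∣ℤ_)
  (trans (cong (λ r → x -ℤ + r -ℤ (y -ℤ + (y %ℕ n))) eq) (lemma x y (+ (y %ℕ n))))
  (∣m∣n⇒∣m-n (∣-%ℕ n x) (∣-%ℕ n y))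
  where
  lemma : ∀ x y r → x -ℤ r -ℤ (y -ℤ r) ≡ x -ℤ y
  lemma = solve-∀

-- Fermat quotients

module _ (m : ℕ) (p-prime : Prime (suc m)) where

  private
    p = suc m

  -- The quotient is kept unreduced so that u^(p-1) = 1 + p Q(u) is an exact identity, which can be
  -- multiplied.
  fullQuotient : ℕ → ℕ
  fullQuotient u = (u ^ m ∸ 1) / p

  ^m-fullQuotient : ∀ u .{{_ : NonZero u}} → u < p → (+ u) ^ℤ m ≡ 1ℤ +ℤ + p *ℤ + fullQuotient u
  ^m-fullQuotient u u<p = begin
    (+ u) ^ℤ m                       ≡⟨ pos-^ u m ⟨
    + (u ^ m)                        ≡⟨ cong +_ (m+[n∸m]≡n (m^n>0 u m)) ⟨
    + (1 + (u ^ m ∸ 1))              ≡⟨ cong (λ n → + (1 + n)) (m/n*n≡m (fermat m p-prime u u<p)) ⟨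
    + (1 + fullQuotient u * p)       ≡⟨ cong (λ n → + (1 + n)) (*-comm (fullQuotient u) p) ⟩
    1ℤ +ℤ + (p * fullQuotient u)     ≡⟨ cong (1ℤ +ℤ_) (ℤ.pos-* p (fullQuotient u)) ⟩
    1ℤ +ℤ + p *ℤ + fullQuotient u    ∎
    where open ≡-Reasoning

  fermatQuotient≡ : ∀ u .{{_ : NonZero u}} → u < p → fermatQuotient p u ≡ fullQuotient u % p
  fermatQuotient≡ u@(suc _) u<p =
    cong (λ r → if r ≡ᵇ 0 then 0 else fullQuotient u % p) (m<n⇒m%n≡m u<p)

  -- The exact quotient for `u * v`, read off from (1 + p a)(1 + p b). Modulo p it is a + b, which
  -- is the additivity of Q.
  productQuotient : ℕ → ℕ → ℤ
  productQuotient u v = a +ℤ b +ℤ + p *ℤ (a *ℤ b)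
    where
    a = + fullQuotient u
    b = + fullQuotient v

  ^m-product : ∀ u v .{{_ : NonZero u}} .{{_ : NonZero v}} → u < p → v < p →
    (+ (u * v)) ^ℤ m ≡ 1ℤ +ℤ + p *ℤ productQuotient u v
  ^m-product u v u<p v<p = begin
    (+ (u * v)) ^ℤ m            ≡⟨ cong (_^ℤ m) (ℤ.pos-* u v) ⟩
    (+ u *ℤ + v) ^ℤ m           ≡⟨ ^ℤ-distribʳ-* (+ u) (+ v) m ⟩
    (+ u) ^ℤ m *ℤ (+ v) ^ℤ m    ≡⟨ cong₂ _*ℤ_ (^m-fullQuotient u u<p) (^m-fullQuotient v v<p) ⟩
    (1ℤ +ℤ + p *ℤ a) *ℤ (1ℤ +ℤ + p *ℤ b) ≡⟨ lemma a b (+ p) ⟩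
    1ℤ +ℤ + p *ℤ productQuotient u v ∎
    where
    open ≡-Reasoning
    a = + fullQuotient u
    b = + fullQuotient v
    lemma : ∀ a b p → (1ℤ +ℤ p *ℤ a) *ℤ (1ℤ +ℤ p *ℤ b) ≡ 1ℤ +ℤ p *ℤ (a +ℤ b +ℤ p *ℤ (a *ℤ b))
    lemma = solve-∀

  module _ (k : ℤ) where

    -- The position of q_p(u) in the interval modulo p, counted from 0 at k + 1.
    offset : ℕ → ℕ
    offset u = (+ fermatQuotient p u -ℤ k -ℤ 1ℤ) %ℕ p

    fullQuotient-offset : ∀ u .{{_ : NonZero u}} → u < p →
      + p ∣ℤ + fullQuotient u -ℤ (+ offset u +ℤ k +ℤ 1ℤ)
    fullQuotient-offset u u<p = subst (+ p ∣ℤ_)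
      (trans (cong (λ r → + Q -ℤ + r +ℤ (+ q -ℤ k -ℤ 1ℤ -ℤ + offset u)) (sym (fermatQuotient≡ u u<p)))
             (lemma (+ Q) (+ q) k (+ offset u)))
      (∣m∣n⇒∣m+n (∣-%ℕ p (+ Q)) (∣-%ℕ p (+ q -ℤ k -ℤ 1ℤ)))
      where
      Q = fullQuotient u
      q = fermatQuotient p u
      lemma : ∀ Q q k o → Q -ℤ q +ℤ (q -ℤ k -ℤ 1ℤ -ℤ o) ≡ Q -ℤ (o +ℤ k +ℤ 1ℤ)
      lemma = solve-∀

    -- A hit at index `j` forces `offset u` = `j % p` ≤ `j` < `h`; passing through `j % p` also
    -- covers h > p.
    hits⇒offset< : ∀ h u → T (hits p k h u) → offset u < h
    hits⇒offset< h u hit with j , j∈ , z≡ᵇ0 ← find (any⁻ _ (upTo h) hit) =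
      ≤-<-trans (≤-trans (≤-reflexive offset≡) (m%n≤m j p)) (∈-upTo⁻ j∈)
      where
      z = + fermatQuotient p u -ℤ k -ℤ 1ℤ
      z-j = + fermatQuotient p u -ℤ k -ℤ + suc j
      lemma : ∀ q k j o r → q -ℤ k -ℤ (1ℤ +ℤ j) -ℤ 0ℤ +ℤ (j -ℤ r) -ℤ (q -ℤ k -ℤ 1ℤ -ℤ o) ≡ o -ℤ r
      lemma = solve-∀
      offset≡ : offset u ≡ j % p
      offset≡ = ∣-<⇒≡ (n%ℕd<d z p) (m%n<n j p) (subst (+ p ∣ℤ_)
        (lemma (+ fermatQuotient p u) k (+ j) (+ offset u) (+ (j % p)))
        (∣m∣n⇒∣m-n (∣m∣n⇒∣m+n
            (subst (λ r → + p ∣ℤ z-j -ℤ + r) (≡ᵇ⇒≡ (z-j %ℕ p) 0 z≡ᵇ0) (∣-%ℕ p z-j))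
            (∣-%ℕ p (+ j)))
          (∣-%ℕ p z)))

    -- Each Q is congruent to its offset plus k + 1, so equal offset sums make the product quotients
    -- congruent modulo p. Then uv ≡ u′v′ modulo p², and both products are below p².
    offsets-and-residue-determine-product : ∀ u v u′ v′
      .{{_ : NonZero u}} .{{_ : NonZero v}} .{{_ : NonZero u′}} .{{_ : NonZero v′}} →
      u < p → v < p → u′ < p → v′ < p →
      offset u + offset v ≡ offset u′ + offset v′ → u * v % p ≡ u′ * v′ % p → u * v ≡ u′ * v′
    offsets-and-residue-determine-product u v u′ v′ u<p v<p u′<p v′<p o≡ r≡ =
      ∣-<⇒≡ (*-mono-< u<p v<p) (*-mono-< u′<p v′<p)
        (residue-and-quotient-determine m (+ (u * v)) (+ (u′ * v′))
          (productQuotient u v) (productQuotient u′ v′)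
          (^m-product u v u<p v<p) (^m-product u′ v′ u′<p v′<p)
          (%ℕ≡⇒∣- p (+ (u * v)) (+ (u′ * v′)) r≡) quotients≡)
      where
      a = + fullQuotient u
      b = + fullQuotient v
      a′ = + fullQuotient u′
      b′ = + fullQuotient v′
      o≡ℤ : + offset u +ℤ + offset v ≡ + offset u′ +ℤ + offset v′
      o≡ℤ = cong +_ o≡
      lemma : ∀ a b a′ b′ o n o′ n′ k p →
        (a -ℤ (o +ℤ k +ℤ 1ℤ)) +ℤ (b -ℤ (n +ℤ k +ℤ 1ℤ)) -ℤ ((a′ -ℤ (o′ +ℤ k +ℤ 1ℤ)) +ℤ (b′ -ℤ (n′ +ℤ k +ℤ 1ℤ)))
          +ℤ p *ℤ (a *ℤ b -ℤ a′ *ℤ b′) +ℤ (o +ℤ n -ℤ (o′ +ℤ n′))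
        ≡ (a +ℤ b +ℤ p *ℤ (a *ℤ b)) -ℤ (a′ +ℤ b′ +ℤ p *ℤ (a′ *ℤ b′))
      lemma = solve-∀
      quotients≡ : + p ∣ℤ productQuotient u v -ℤ productQuotient u′ v′
      quotients≡ = subst (+ p ∣ℤ_)
        (lemma a b a′ b′ (+ offset u) (+ offset v) (+ offset u′) (+ offset v′) k (+ p))
        (∣m∣n⇒∣m+n (∣m∣n⇒∣m+n
          (∣m∣n⇒∣m-n
            (∣m∣n⇒∣m+n (fullQuotient-offset u u<p) (fullQuotient-offset v v<p))
            (∣m∣n⇒∣m+n (fullQuotient-offset u′ u′<p) (fullQuotient-offset v′ v′<p)))
          (∣m⇒∣m*n _ ℤ.∣-refl))
          (ℤ.divides 0ℤ (ℤ.i≡j⇒i-j≡0 o≡ℤ)))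

    -- Counting pairs of hits by their product

    module _ (h : ℕ) where

      nonzeroHits : List ℕ
      nonzeroHits = filter (λ u → T? (hits p k h u)) (applyUpTo suc m)

      ∈-nonzeroHits⁻ : ∀ {u} → u ∈ nonzeroHits → NonZero u × u < p × offset u < h
      ∈-nonzeroHits⁻ u∈ with u∈′ , hit ← ∈-filter⁻ (λ u → T? (hits p k h u)) {xs = applyUpTo suc m} u∈
        with i , i<m , refl ← ∈-applyUpTo⁻ suc u∈′ = _ , s<s i<m , hits⇒offset< h (suc i) hit

      -- The argument u = 0, to which Fermat's little theorem does not apply, contributes at most
      -- one hit.
      U≤1+nonzeroHits : U p k h ≤ suc (length nonzeroHits)
      U≤1+nonzeroHits with hits p k h 0
      ... | true = ≤-refl
      ... | false = n≤1+n _

      nonzeroHits-unique : Unique nonzeroHits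
      nonzeroHits-unique = Unique.filter⁺ _ (Unique.applyUpTo⁺₁ suc m λ i<j _ → <⇒≢ (s<s i<j))

      -- Pairs of hits are sorted by offset sum, which is below 2h, and by the residue of the
      -- product. All pairs in a class share one product w < p², so a class has at most τ(w)
      -- members.
      nonzeroHits²≤ : ∀ t → (∀ w .{{_ : NonZero w}} → w < p * p → τ w ≤ t) →
        length nonzeroHits * length nonzeroHits ≤ (h + h) * p * t
      nonzeroHits²≤ t τ≤t = begin
        length nonzeroHits * length nonzeroHits ≡⟨ length-cartesianProductWith _,_ nonzeroHits nonzeroHits ⟨
        length pairs                            ≤⟨ length-fibres (≡-dec _≟_ _≟_) class t classes
                                                     (Unique.cartesianProduct⁺ nonzeroHits-unique nonzeroHits-unique) class∈ fibre≤ ⟩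
        length classes * t                      ≡⟨ cong (_* t) (length-cartesianProductWith _,_ (upTo (h + h)) (upTo p)) ⟩
        length (upTo (h + h)) * length (upTo p) * t ≡⟨ cong₂ (λ a b → a * b * t) (length-upTo (h + h)) (length-upTo p) ⟩
        (h + h) * p * t                         ∎
        where
        open ≤-Reasoning
        pairs = cartesianProduct nonzeroHits nonzeroHits
        classes = cartesianProduct (upTo (h + h)) (upTo p)
        class : ℕ × ℕ → ℕ × ℕ
        class (u , v) = offset u + offset v , u * v % p
        class∈ : ∀ {r} → r ∈ pairs → class r ∈ classes
        class∈ {u , v} r∈ with u∈ , v∈ ← ∈-cartesianProduct⁻ nonzeroHits nonzeroHits r∈
          with _ , _ , o<h ← ∈-nonzeroHits⁻ u∈ | _ , _ , n<h ← ∈-nonzeroHits⁻ v∈ =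
          ∈-cartesianProduct⁺ (∈-upTo⁺ (+-mono-< o<h n<h)) (∈-upTo⁺ (m%n<n (u * v) p))
        fibre≤ : ∀ y {zs} → Unique zs → zs ⊆ pairs → (∀ {z} → z ∈ zs → class z ≡ y) → length zs ≤ t
        fibre≤ y {[]} _ _ _ = z≤n
        -- The first pair of the class supplies the product whose factor pairs contain the whole
        -- class.
        fibre≤ y {(u , v) ∷ _} zs! zs⊆ class≡
          with u∈ , v∈ ← ∈-cartesianProduct⁻ nonzeroHits nonzeroHits (zs⊆ (here refl))
          with u≢0 , u<p , _ ← ∈-nonzeroHits⁻ u∈ | v≢0 , v<p , _ ← ∈-nonzeroHits⁻ v∈ =
          ≤-trans (unique-⊆⇒length-≤ zs! samePair) (τ≤t (u * v) {{m*n≢0 u v {{u≢0}} {{v≢0}}}} (*-mono-< u<p v<p))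
          where
          samePair : _ ⊆ factorPairs (u * v)
          samePair {u′ , v′} r∈
            with u′∈ , v′∈ ← ∈-cartesianProduct⁻ nonzeroHits nonzeroHits (zs⊆ r∈)
            with u′≢0 , u′<p , _ ← ∈-nonzeroHits⁻ u′∈ | v′≢0 , v′<p , _ ← ∈-nonzeroHits⁻ v′∈
            with eq ← trans (class≡ r∈) (sym (class≡ (here refl))) =
            ∈-factorPairs⁺ {{m*n≢0 u v {{u≢0}} {{v≢0}}}}
              (offsets-and-residue-determine-product u′ v′ u v {{u′≢0}} {{v′≢0}} {{u≢0}} {{v≢0}}
                u′<p v′<p u<p v<p (cong proj₁ eq) (cong proj₂ eq))

-- The uniform bound and the conclusion

argmax : (f : ℕ → ℕ) (n : ℕ) → ∃ λ i → i ≤ n × (∀ j → j ≤ n → f j ≤ f i)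
argmax f zero = 0 , z≤n , λ { zero z≤n → ≤-refl }
argmax f (suc n) with i , i≤n , max ← argmax f n | ≤-total (f i) (f (suc n))
... | inj₁ fi≤ = suc n , ≤-refl , λ j j≤1+n →
  [ (λ j<1+n → ≤-trans (max j (s≤s⁻¹ j<1+n)) fi≤) , (λ { refl → ≤-refl }) ]′ (m≤n⇒m<n∨m≡n j≤1+n)
... | inj₂ ≤fi = i , m≤n⇒m≤1+n i≤n , λ j j≤1+n →
  [ (λ j<1+n → max j (s≤s⁻¹ j<1+n)) , (λ { refl → ≤fi }) ]′ (m≤n⇒m<n∨m≡n j≤1+n)

-- Since `divisorBound` controls a power of τ, the bound is stated through a `w` that maximises τ,
-- and no root has to be taken. This `w` is chosen before `k` and `h`.
U²≤ : ∀ m → Prime (suc m) → ∃ λ w → NonZero w × w ≤ suc m * suc m ×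
  (∀ k h → 1 ≤ h → U (suc m) k h ^ 2 ≤ h * (suc m * (8 * τ w)))
-- The index bound is p² - 1, so `suc i` ranges over 1, ..., p².
U²≤ m p-prime with i , i≤n , max ← argmax (τ ∘ suc) (m + m * suc m) =
  suc i , _ , s≤s i≤n , bound
  where
  open ≤-Reasoning
  p = suc m
  t = τ (suc i)
  τ≤t : ∀ w .{{_ : NonZero w}} → w < p * p → τ w ≤ t
  τ≤t (suc j) (s≤s j<n) = max j (<⇒≤ j<n)
  1≤t : 1 ≤ t
  1≤t = ∈-length (∈-factorPairs⁺ {1} {suc i} (*-identityˡ (suc i)))
  bound : ∀ k h → 1 ≤ h → U p k h ^ 2 ≤ h * (p * (8 * t))
  bound k h 1≤h with length (nonzeroHits m p-prime k h) | U≤1+nonzeroHits m p-prime k h | nonzeroHits²≤ m p-prime k h t τ≤t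
  ... | zero | U≤1 | _ = begin
    U p k h ^ 2        ≤⟨ ^-monoˡ-≤ 2 U≤1 ⟩
    1                  ≤⟨ *-mono-≤ 1≤h (*-mono-≤ {1} {p} (s≤s z≤n) (*-mono-≤ {1} {8} (s≤s z≤n) 1≤t)) ⟩
    h * (p * (8 * t))  ∎
  -- For s ≥ 1 one has 1 + s ≤ 2s. Squaring gives 4, and the 2h offset sums give the other 2 in the
  -- constant 8.
  ... | s@(suc s-1) | U≤1+s | s²≤ = begin
    U p k h ^ 2              ≤⟨ ^-monoˡ-≤ 2 (≤-trans U≤1+s (+-monoˡ-≤ s (s≤s (z≤n {s-1})))) ⟩
    (s + s) ^ 2              ≡⟨ double² s ⟩
    4 * (s * s)              ≤⟨ *-monoʳ-≤ 4 s²≤ ⟩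
    4 * ((h + h) * p * t)    ≡⟨ regroup h p t ⟩
    h * (p * (8 * t))        ∎
    where
    double² : ∀ s → (s + s) * ((s + s) * 1) ≡ 4 * (s * s)
    double² = ℕ-solve-∀
    regroup : ∀ h p t → 4 * ((h + h) * p * t) ≡ h * (p * (8 * t))
    regroup = ℕ-solve-∀

^2-cancel-≤ : ∀ {x y} → x ^ 2 ≤ y ^ 2 → x ≤ y
^2-cancel-≤ {x} {y} x²≤y² with x ≤? y
... | yes x≤y = x≤y
... | no x≰y = contradiction x²≤y² (<⇒≱ (^-monoˡ-< 2 (≰⇒> x≰y)))

-- The exponent error o(1) is tested against every rational ε = a / b, and U ≤ h^(1/2) p^(1/2 + ε)
-- is raised to the power 2b. The threshold `P` precedes `k` and `h`, so the bound is uniform in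
-- both.
theorem9 : (a b : ℕ) → 1 ≤ a → 1 ≤ b →
    ∃ λ (P : ℕ) → ∀ (p : ℕ) → Prime p → P ≤ p →
    ∀ (k : ℤ) (h : ℕ) → 1 ≤ h →
    U p k h ^ (2 * b) ≤ h ^ b * p ^ (b + 2 * a)
theorem9 a b@(suc _) 1≤a _ with D , τ≤ ← divisorBound (b * 2) =
  -- Both constants in the bound for (8 τ(w))^(2b) are absorbed into one factor p, while w ≤ p²
  -- gives two more.
  8 ^ (b * 2) * D , bound
  where
  open ≤-Reasoning
  bound : ∀ p → Prime p → 8 ^ (b * 2) * D ≤ p → ∀ k h → 1 ≤ h →
    U p k h ^ (2 * b) ≤ h ^ b * p ^ (b + 2 * a)
  bound zero p-prime = contradiction p-prime ¬prime[0]
  bound p@(suc m) p-prime P≤p k h 1≤h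
    with w , w≢0 , w≤p² , U²≤′ ← U²≤ m p-prime = begin
    U p k h ^ (2 * b)                ≡⟨ ^-*-assoc (U p k h) 2 b ⟨
    (U p k h ^ 2) ^ b                ≤⟨ ^-monoˡ-≤ b (U²≤′ k h 1≤h) ⟩
    (h * (p * (8 * τ w))) ^ b        ≡⟨ ^-distribʳ-* h (p * (8 * τ w)) b ⟩
    h ^ b * (p * (8 * τ w)) ^ b      ≡⟨ cong (h ^ b *_) (^-distribʳ-* p (8 * τ w) b) ⟩
    h ^ b * (p ^ b * (8 * τ w) ^ b)  ≤⟨ *-monoʳ-≤ (h ^ b) (*-monoʳ-≤ (p ^ b) [8τ]^b≤) ⟩
    h ^ b * (p ^ b * p ^ (2 * a))    ≡⟨ cong (h ^ b *_) (^-distribˡ-+-* p b (2 * a)) ⟨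
    h ^ b * p ^ (b + 2 * a)          ∎
    where
    -- Rounding p³ up to the square p⁴ makes the square root exact: (8 τ(w))^b ≤ p² ≤ p^(2a), as a ≥
    -- 1.
    p³≤ : p * (p * p) ≤ (p ^ 2) ^ 2
    p³≤ = begin
      p * (p * p)      ≤⟨ m≤n*m (p * (p * p)) p ⟩
      p * (p * (p * p)) ≡⟨ fourth p ⟩
      (p ^ 2) ^ 2      ∎
      where
      fourth : ∀ p → p * (p * (p * p)) ≡ p * (p * 1) * (p * (p * 1) * 1)
      fourth = ℕ-solve-∀
    [8τ]^b≤ : (8 * τ w) ^ b ≤ p ^ (2 * a)
    [8τ]^b≤ = ≤-trans (^2-cancel-≤ (begin
      ((8 * τ w) ^ b) ^ 2                ≡⟨ ^-*-assoc (8 * τ w) b 2 ⟩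
      (8 * τ w) ^ (b * 2)                ≡⟨ ^-distribʳ-* 8 (τ w) (b * 2) ⟩
      8 ^ (b * 2) * τ w ^ (b * 2)        ≤⟨ *-monoʳ-≤ (8 ^ (b * 2)) (τ≤ w {{w≢0}}) ⟩
      8 ^ (b * 2) * (D * w)              ≡⟨ *-assoc (8 ^ (b * 2)) D w ⟨
      8 ^ (b * 2) * D * w                ≤⟨ *-mono-≤ P≤p w≤p² ⟩
      p * (p * p)                        ≤⟨ p³≤ ⟩
      (p ^ 2) ^ 2                        ∎))
      (^-monoʳ-≤ p (*-monoʳ-≤ 2 1≤a))
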